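{- Let $\mathbf P$ be a cyclic CFSM protocol with the rational channel property and communication graph $(N,E)$, and let $\beta\in E$. A composite state $S'$ is not stable if and only if there is a family of regular sets $Q(S)\subseteq M_\beta^*$, $S\in\prod_{j\in N}K_j$, consistent with respect to $\mathbf P$ and $\beta$, such that $\lambda\in Q(S^0)$ and $\lambda\notin Q(S')$.
   Context: A CFSM protocol $\mathbf P$ has a finite directed communication graph $G=(N,E)$ (edge $\xi$ has tail $-\xi$, head $+\xi$), pairwise disjoint finite message sets $M_\xi$, and for each $j\in N$ a finite state machine $F_j=(K_j,\Sigma_j,T_j,h_j)$: finite state set $K_j$, initial state $h_j$, alphabet $\Sigma_j=\{+b: b\in M_\xi,\ j=+\xi\}\cup\{ -b: b\in M_\xi,\ j=-\xi\}$, transitions $T_j\subseteq K_j\times\Sigma_j\times K_j$ ($+b$ = receive, $-b$ = send). A composite state is $S=(p_j:j\in N)$; a channel content is $C=(x_\xi:\xi\in E)$, $x_\xi\in M_\xi^*$; global states are pairs $(S,C)$; $C^0$ has all components equal to the empty word $\lambda$; $S^0=(h_j:j\in N)$ and $(S^0,C^0)$ is the initial global state. A step: some machine $F_i$ takes $p_i\xrightarrow{ -b}q_i$ with $b\in M_\beta$, $i=-\beta$, appending $b$ to the end of $x_\beta$; or takes $p_i\xrightarrow{+b}q_i$ with $b\in M_\beta$, $i=+\beta$, provided $x_\beta$ begins with $b$, removing it; all else unchanged. $\vdash^*$ means reachability by finitely many steps. A composite state $S$ is stable if $(S^0,C^0)\vdash^*(S,C^0)$. $\mathbf L(S)=\{C:(S^0,C^0)\vdash^*(S,C)\}$.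 A subset of $\prod_{\xi\in E}M_\xi^*$ is rational if it belongs to the smallest family containing finite sets and closed under union, componentwise product and Kleene star; $\mathbf P$ has the rational channel property if every $\mathbf L(S)$ is rational. $\mathbf P$ is cyclic if $G$ is a directed cycle. A family $Q(S)\subseteq M_\beta^*$ is consistent with respect to $\mathbf P$ and $\beta$ if whenever $(S,(x_\xi))\vdash^*(S',(x'_\xi))$ with $x_\xi=x'_\xi=\lambda$ for $\xi\neq\beta$ and $x_\beta\in Q(S)$, then $x'_\beta\in Q(S')$. -}

module Defs where

open import Level using (0ℓ)
open import Algebra.Bundles using (Monoid)
open import Data.Fin.Base using (Fin; toℕ)
open import Data.List.Base using (List; []; _∷_; _++_; [_])
open import Data.List.Properties using (++-monoid; ++-assoc; ++-identityˡ; ++-identityʳ)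
import Data.List.Membership.Setoid as Membership
open import Data.Nat.Base using (suc)
open import Data.Nat.DivMod using (_mod_)
open import Data.Product.Base using (Σ-syntax; ∃-syntax; _×_; _,_)
open import Function.Bundles using (_↔_; Inverse)
open import Relation.Binary.PropositionalEquality using (_≡_; _≢_; refl; sym; trans; cong₂)
open import Relation.Unary using (Pred; _∪_; _≐_; _∈_)

Finite : Set → Set
Finite A = ∃[ n ] (A ↔ Fin n)

module RationalSubsets (𝓜 : Monoid 0ℓ 0ℓ) where
  open Monoid 𝓜 using (Carrier; _≈_; _∙_; ε; setoid)

  Subset : Set₁
  Subset = Pred Carrier 0ℓ

  ⟦_⟧ : List Carrier → Subset
  ⟦ xs ⟧ x = Membership._∈_ setoid x xs

  _·_ : Subset → Subset → Subset
  (A · B) x = ∃[ y ] ∃[ z ] (y ∈ A × z ∈ B × x ≈ y ∙ z)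

  data _⋆ (A : Subset) : Subset where
    stop : ∀ {x} → x ≈ ε → (A ⋆) x
    more : ∀ {x y z} → y ∈ A → (A ⋆) z → x ≈ y ∙ z → (A ⋆) x

  -- Subsets are predicates, so "the same subset" is mutual inclusion _≐_;
  -- the constructor `resp` makes the family one of subsets in this sense.
  data Rational : Subset → Set₁ where
    finite  : (xs : List Carrier) → Rational ⟦ xs ⟧
    union   : ∀ {A B} → Rational A → Rational B → Rational (A ∪ B)
    product : ∀ {A B} → Rational A → Rational B → Rational (A · B)
    star    : ∀ {A} → Rational A → Rational (A ⋆)
    resp    : ∀ {A B} → A ≐ B → Rational A → Rational B

-- The regular sets over an alphabet are the rational subsets of the free monoid.
Regular : {A : Set} → Pred (List A) 0ℓ → Set₁
Regular {A} = RationalSubsets.Rational (++-monoid A)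

-- ∏_ξ (M ξ)*, tuples being functions compared pointwise.
wordTuples : {E : Set} → (E → Set) → Monoid 0ℓ 0ℓ
wordTuples {E} M = record
  { Carrier  = (ξ : E) → List (M ξ)
  ; _≈_      = λ C D → ∀ ξ → C ξ ≡ D ξ
  ; _∙_      = λ C D ξ → C ξ ++ D ξ
  ; ε        = λ _ → []
  ; isMonoid = record
    { isSemigroup = record
      { isMagma = record
        { isEquivalence = record
          { refl  = λ _ → refl
          ; sym   = λ p ξ → sym (p ξ)
          ; trans = λ p q ξ → trans (p ξ) (q ξ)
          }
        ; ∙-cong = λ p q ξ → cong₂ _++_ (p ξ) (q ξ)
        }
      ; assoc = λ C D F ξ → ++-assoc (C ξ) (D ξ) (F ξ)
      }
    ; identity = (λ C ξ → ++-identityˡ (C ξ)) , (λ C ξ → ++-identityʳ (C ξ))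
    }
  }

record Digraph : Set₁ where
  field
    N E        : Set
    N-finite   : Finite N
    E-finite   : Finite E
    tail head  : E → N

-- For some n ≥ 1 the nodes are ν₀, …, νₙ₋₁ and the edges are η₀, …, ηₙ₋₁,
-- with ηᵢ going from νᵢ to ν₍ᵢ₊₁ mod n₎; in the code n is `suc k`.
IsDirectedCycle : Digraph → Set
IsDirectedCycle G =
  ∃[ k ] Σ[ ν ∈ Fin (suc k) ↔ N ] Σ[ η ∈ Fin (suc k) ↔ E ]
    (∀ i → tail (Inverse.to η i) ≡ Inverse.to ν i
         × head (Inverse.to η i) ≡ Inverse.to ν (suc (toℕ i) mod suc k))
  where open Digraph G

-- The alphabet Σ_j. A letter records the edge its message belongs to, so the
-- message sets of distinct edges are disjoint by construction.
data Letter (G : Digraph) (M : Digraph.E G → Set) : Digraph.N G → Set where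
  recv : ∀ {ξ} → M ξ → Letter G M (Digraph.head G ξ)
  send : ∀ {ξ} → M ξ → Letter G M (Digraph.tail G ξ)

record Protocol : Set₁ where
  field
    graph : Digraph
  open Digraph graph public
  field
    M        : E → Set
    M-finite : ∀ ξ → Finite (M ξ)
    K        : N → Set
    K-finite : ∀ j → Finite (K j)
    T        : ∀ j → K j → Letter graph M j → K j → Set
    h        : ∀ j → K j

module Semantics (P : Protocol) where
  open Protocol P public

  Composite : Set
  Composite = ∀ j → K j

  Channels : Set
  Channels = ∀ ξ → List (M ξ)

  Global : Set
  Global = Composite × Channels

  S⁰ : Composite
  S⁰ = h

  C⁰ : Channels
  C⁰ _ = []

  _≈_ : Global → Global → Set
  (S , C) ≈ (S′ , C′) = (∀ j → S j ≡ S′ j) × (∀ ξ → C ξ ≡ C′ ξ)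

  infix 4 _≈_ _⊢_ _⊢*_

  data _⊢_ : Global → Global → Set where
    send-step : ∀ {S C S′ C′ β} (b : M β) →
      T (tail β) (S (tail β)) (send b) (S′ (tail β)) →
      (∀ j → j ≢ tail β → S′ j ≡ S j) →
      C′ β ≡ C β ++ [ b ] →
      (∀ ξ → ξ ≢ β → C′ ξ ≡ C ξ) →
      (S , C) ⊢ (S′ , C′)
    recv-step : ∀ {S C S′ C′ β} (b : M β) →
      T (head β) (S (head β)) (recv b) (S′ (head β)) →
      (∀ j → j ≢ head β → S′ j ≡ S j) →
      C β ≡ b ∷ C′ β →
      (∀ ξ → ξ ≢ β → C′ ξ ≡ C ξ) →
      (S , C) ⊢ (S′ , C′)

  -- Reflexive up to pointwise equality: without function extensionality, `Star _⊢_`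
  -- would distinguish equal tuples in its zero-step case.
  data _⊢*_ : Global → Global → Set where
    done : ∀ {s t} → s ≈ t → s ⊢* t
    _◅_  : ∀ {s t u} → s ⊢ t → t ⊢* u → s ⊢* u

  Stable : Composite → Set
  Stable S = (S⁰ , C⁰) ⊢* (S , C⁰)

  L : Composite → Pred Channels 0ℓ
  L S C = (S⁰ , C⁰) ⊢* (S , C)

  RationalChannelProperty : Set₁
  RationalChannelProperty = ∀ S → RationalSubsets.Rational (wordTuples M) (L S)

  Cyclic : Set
  Cyclic = IsDirectedCycle graph

  Consistent : (β : E) → (Composite → Pred (List (M β)) 0ℓ) → Set
  Consistent β Q = ∀ S C S′ C′ → (S , C) ⊢* (S′ , C′) →
    (∀ ξ → ξ ≢ β → C ξ ≡ [] × C′ ξ ≡ []) →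
    C β ∈ Q S → C′ β ∈ Q S′

{-# OPTIONS --safe #-}

-- Take for Q(S) the words x such that the channel content with x on β and λ
-- elsewhere lies in L(S). The contents that are empty off β form a submonoid
-- that contains the factors of each of its elements, so restricting to it
-- commutes with products and stars and preserves rationality.
module Submission where

open import Level using (0ℓ)
open import Data.Fin.Properties using (all?; inj⇒≟)
open import Data.List.Base using (List; []; _∷_; _++_; map; filter)
open import Data.List.Properties using (++-monoid; ++-conicalˡ; ++-conicalʳ)
import Data.List.Membership.Setoid.Properties as Membershipₚ
open import Data.Product.Base using (Σ-syntax; ∃-syntax; _×_; _,_; proj₁; proj₂)
open import Data.Sum.Base using (inj₁; inj₂)
open import Function.Bundles using (_⇔_; mk⇔; Inverse)
open import Function.Properties.Inverse using (↔⇒↣)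
open import Relation.Binary.Definitions using (DecidableEquality)
open import Relation.Binary.PropositionalEquality using (_≡_; _≢_; refl; sym; trans; cong; cong₂; subst)
open import Relation.Nullary.Decidable using (Dec; yes; no; map′; ¬?; _→-dec_)
open import Relation.Nullary.Negation.Core using (¬_)
open import Relation.Unary using (Pred; Decidable; _∪_; _≐_; _∈_; _∉_)
open import Algebra.Bundles using (Monoid)
open import Defs

≡[]? : ∀ {A : Set} (xs : List A) → Dec (xs ≡ [])
≡[]? []      = yes refl
≡[]? (_ ∷ _) = no λ ()

finite⇒≟ : ∀ {A : Set} → Finite A → DecidableEquality A
finite⇒≟ (_ , A↔Fin) = inj⇒≟ (↔⇒↣ A↔Fin)

finite⇒∀? : ∀ {A : Set} → Finite A → {R : Pred A 0ℓ} → Decidable R → Dec (∀ x → R x)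
finite⇒∀? (_ , A↔Fin) {R} R? = map′
  (λ f x → subst R (strictlyInverseʳ x) (f (to x)))
  (λ f i → f (from i))
  (all? (λ i → R? (from i)))
  where open Inverse A↔Fin

module Slices {E : Set} (E-finite : Finite E) (M : E → Set) (β : E) where
  module Tuples = RationalSubsets (wordTuples M)
  module Words  = RationalSubsets (++-monoid (M β))
  open Monoid (wordTuples M) using (Carrier; setoid; _∙_)

  EmptyOff : Pred Carrier 0ℓ
  EmptyOff C = ∀ ξ → ξ ≢ β → C ξ ≡ []

  -- Finiteness of `E` makes both the comparison with `β` and the quantifier over edges decidable.
  -- This is what allows a finite list of tuples to be filtered in `slice-finite`.
  emptyOff? : Decidable EmptyOff
  emptyOff? C = finite⇒∀? E-finite λ ξ → ¬? (finite⇒≟ E-finite ξ β) →-dec ≡[]? (C ξ)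

  -- Formulated as a projection, so that no tuple with `x` on `β` and empty words elsewhere has to
  -- be built by a case split on `ξ ≡ β`.
  Slice : Tuples.Subset → Words.Subset
  Slice A x = ∃[ C ] (C ∈ A × C β ≡ x × EmptyOff C)

  emptyOff-∙ : ∀ {C D} → EmptyOff C → EmptyOff D → EmptyOff (C ∙ D)
  emptyOff-∙ eC eD ξ ξ≢β = cong₂ _++_ (eC ξ ξ≢β) (eD ξ ξ≢β)

  -- In a free monoid a product is empty only when both factors are. Hence a factorization of a
  -- tuple in the slice never leaves the slice, which gives the harder inclusions for products and
  -- stars.
  emptyOff-factors : ∀ {B C D} → (∀ ξ → B ξ ≡ (C ∙ D) ξ) → EmptyOff B → EmptyOff C × EmptyOff D
  emptyOff-factors {_} {C} {D} B≈CD eB =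
    (λ ξ ξ≢β → ++-conicalˡ (C ξ) (D ξ) (trans (sym (B≈CD ξ)) (eB ξ ξ≢β))) ,
    (λ ξ ξ≢β → ++-conicalʳ (C ξ) (D ξ) (trans (sym (B≈CD ξ)) (eB ξ ξ≢β)))

  emptyOff-resp : ∀ {C D} → (∀ ξ → C ξ ≡ D ξ) → EmptyOff C → EmptyOff D
  emptyOff-resp C≈D eC ξ ξ≢β = trans (sym (C≈D ξ)) (eC ξ ξ≢β)

  slice-finite : ∀ Cs → Words.⟦ map (λ C → C β) (filter emptyOff? Cs) ⟧ ≐ Slice Tuples.⟦ Cs ⟧
  slice-finite Cs = ⊆ , ⊇
    where
    ⊆ : ∀ {x} → x ∈ Words.⟦ map (λ C → C β) (filter emptyOff? Cs) ⟧ → x ∈ Slice Tuples.⟦ Cs ⟧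
    ⊆ x∈ with Membershipₚ.∈-map⁻ setoid (Monoid.setoid (++-monoid (M β))) x∈
    ... | C , C∈filter , x≡Cβ
      with C∈Cs , eC ← Membershipₚ.∈-filter⁻ setoid emptyOff? emptyOff-resp C∈filter
      = C , C∈Cs , sym x≡Cβ , eC

    ⊇ : ∀ {x} → x ∈ Slice Tuples.⟦ Cs ⟧ → x ∈ Words.⟦ map (λ C → C β) (filter emptyOff? Cs) ⟧
    ⊇ (C , C∈Cs , refl , eC) =
      Membershipₚ.∈-map⁺ setoid (Monoid.setoid (++-monoid (M β))) (λ C≈D → C≈D β)
        (Membershipₚ.∈-filter⁺ setoid emptyOff? emptyOff-resp C∈Cs eC)

  slice-∪ : ∀ {A B} → (Slice A ∪ Slice B) ≐ Slice (A ∪ B)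
  slice-∪ =
    (λ { (inj₁ (C , C∈A , r)) → C , inj₁ C∈A , r ; (inj₂ (C , C∈B , r)) → C , inj₂ C∈B , r }) ,
    (λ { (C , inj₁ C∈A , r) → inj₁ (C , C∈A , r) ; (C , inj₂ C∈B , r) → inj₂ (C , C∈B , r) })

  slice-· : ∀ {A B} → (Slice A Words.· Slice B) ≐ Slice (A Tuples.· B)
  slice-· =
    (λ { (_ , _ , (C , C∈A , refl , eC) , (D , D∈B , refl , eD) , x≡) →
         C ∙ D , (C , D , C∈A , D∈B , λ _ → refl) , sym x≡ , emptyOff-∙ eC eD }) ,
    (λ { (_ , (C , D , C∈A , D∈B , eq) , refl , e) → let eC , eD = emptyOff-factors eq e in
         C β , D β , (C , C∈A , refl , eC) , (D , D∈B , refl , eD) , eq β })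

  slice-⋆ : ∀ {A} → (Slice A Words.⋆) ≐ Slice (A Tuples.⋆)
  slice-⋆ {A} = ⊆ , λ { (_ , C∈A⋆ , refl , eC) → ⊇ C∈A⋆ eC }
    where
    ⊆ : ∀ {x} → x ∈ (Slice A Words.⋆) → x ∈ Slice (A Tuples.⋆)
    ⊆ (Words.stop x≡[]) = (λ _ → []) , Tuples.stop (λ _ → refl) , sym x≡[] , λ _ _ → refl
    ⊆ (Words.more (C , C∈A , refl , eC) z∈ x≡) with ⊆ z∈
    ... | D , D∈A⋆ , refl , eD =
      C ∙ D , Tuples.more C∈A D∈A⋆ (λ _ → refl) , sym x≡ , emptyOff-∙ eC eD

    -- Emptiness is a separate argument, so that the recursion runs on the star derivation and hands
    -- emptiness on to the remaining factor.
    ⊇ : ∀ {C} → C ∈ (A Tuples.⋆) → EmptyOff C → C β ∈ (Slice A Words.⋆)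
    ⊇ (Tuples.stop C≈ε) _ = Words.stop (C≈ε β)
    ⊇ (Tuples.more {y = C} C∈A D∈A⋆ eq) e = let eC , eD = emptyOff-factors eq e in
      Words.more (C , C∈A , refl , eC) (⊇ D∈A⋆ eD) (eq β)

  slice-mono : ∀ {A B : Tuples.Subset} → (∀ {C} → C ∈ A → C ∈ B) → ∀ {x} → x ∈ Slice A → x ∈ Slice B
  slice-mono A⊆B (C , C∈A , r) = C , A⊆B C∈A , r

  -- Induction on the derivation of rationality: slicing commutes with each constructor up to `≐`,
  -- and `resp` absorbs that difference.
  slice-regular : ∀ {A} → Tuples.Rational A → Regular (Slice A)
  slice-regular (Tuples.finite Cs)   = Words.resp (slice-finite Cs) (Words.finite _)
  slice-regular (Tuples.union a b)   = Words.resp slice-∪ (Words.union (slice-regular a) (slice-regular b))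
  slice-regular (Tuples.product a b) = Words.resp slice-· (Words.product (slice-regular a) (slice-regular b))
  slice-regular (Tuples.star a)      = Words.resp slice-⋆ (Words.star (slice-regular a))
  slice-regular (Tuples.resp (A⊆B , B⊆A) a) =
    Words.resp (slice-mono A⊆B , slice-mono B⊆A) (slice-regular a)

module Reachability (P : Protocol) where
  open Semantics P

  -- A step sees its source only through values at single nodes and edges, so its premises can be
  -- rewritten along pointwise equalities. Composing runs requires this, because `done` may end in a
  -- tuple that is only pointwise equal to the start of the next run.
  ⊢-respˡ : ∀ {s t u} → s ≈ t → t ⊢ u → s ⊢ u
  ⊢-respˡ (S≡ , C≡) (send-step {S′ = S′} {β = β} b τ S-same C′β C-same) =
    send-step b (subst (λ p → T _ p (send b) (S′ (tail β))) (sym (S≡ (tail β))) τ)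
      (λ j j≢ → trans (S-same j j≢) (sym (S≡ j)))
      (trans C′β (cong (_++ _) (sym (C≡ β))))
      (λ ξ ξ≢ → trans (C-same ξ ξ≢) (sym (C≡ ξ)))
  ⊢-respˡ (S≡ , C≡) (recv-step {S′ = S′} {β = β} b τ S-same Cβ C-same) =
    recv-step b (subst (λ p → T _ p (recv b) (S′ (head β))) (sym (S≡ (head β))) τ)
      (λ j j≢ → trans (S-same j j≢) (sym (S≡ j)))
      (trans (C≡ β) Cβ)
      (λ ξ ξ≢ → trans (C-same ξ ξ≢) (sym (C≡ ξ)))

  ⊢*-respˡ : ∀ {s t u} → s ≈ t → t ⊢* u → s ⊢* u
  ⊢*-respˡ (S≡ , C≡) (done (S≡′ , C≡′)) =
    done ((λ j → trans (S≡ j) (S≡′ j)) , (λ ξ → trans (C≡ ξ) (C≡′ ξ)))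
  ⊢*-respˡ s≈t (t⊢u ◅ r) = ⊢-respˡ s≈t t⊢u ◅ r

  ⊢*-trans : ∀ {s t u} → s ⊢* t → t ⊢* u → s ⊢* u
  ⊢*-trans (done s≈t) r = ⊢*-respˡ s≈t r
  ⊢*-trans (step ◅ q) r = step ◅ ⊢*-trans q r

  module _ (β : E) where
    open Slices E-finite M β using (EmptyOff; Slice) public

    emptyOff-≈ : ∀ {C D} → EmptyOff C → EmptyOff D → C β ≡ D β → ∀ ξ → C ξ ≡ D ξ
    emptyOff-≈ eC eD Cβ≡Dβ ξ with finite⇒≟ E-finite ξ β
    ... | yes refl = Cβ≡Dβ
    ... | no  ξ≢β  = trans (eC ξ ξ≢β) (sym (eD ξ ξ≢β))

    -- The slice supplies only some `D` with the same word on `β`. As both are empty elsewhere, they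
    -- agree pointwise, and a final `done` leads from `D` to `C`.
    L-slice⁻ : ∀ {S C} → C β ∈ Slice (L S) → EmptyOff C → C ∈ L S
    L-slice⁻ (D , D∈L , Dβ≡Cβ , eD) eC =
      ⊢*-trans D∈L (done ((λ _ → refl) , emptyOff-≈ eD eC Dβ≡Cβ))

    -- A run reaching `(S , C)` is prolonged by the given one. Emptiness of `C` off `β` recovers the
    -- first run from the slice; that of `C′` puts the result back into it.
    slice-consistent : Consistent β (λ S → Slice (L S))
    slice-consistent S C S′ C′ r e x∈ =
      C′ , ⊢*-trans (L-slice⁻ x∈ (λ ξ ξ≢β → proj₁ (e ξ ξ≢β))) r , refl , λ ξ ξ≢β → proj₂ (e ξ ξ≢β)

theorem8p6 : (P : Protocol) → let open Semantics P in
    Cyclic → RationalChannelProperty → (β : E) (S′ : Composite) →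
    (¬ Stable S′) ⇔ (Σ[ Q ∈ (Composite → Pred (List (M β)) 0ℓ) ]
    ((∀ S → Regular (Q S)) × Consistent β Q × [] ∈ Q S⁰ × [] ∉ Q S′))
theorem8p6 P _ rational β S′ = mk⇔
  (λ unstable →
    (λ S → Slice β (L S)) ,
    (λ S → Slices.slice-regular E-finite M β (rational S)) ,
    slice-consistent β ,
    (C⁰ , done ((λ _ → refl) , (λ _ → refl)) , refl , λ _ _ → refl) ,
    -- The empty word in the slice at `S′` yields `C⁰ ∈ L S′`, which is stability by definition.
    λ []∈ → unstable (L-slice⁻ β []∈ (λ _ _ → refl)))
  -- A stabilizing run starts and ends with all channels empty, so consistency carries the empty
  -- word from `Q S⁰` to `Q S′`.
  (λ { (_ , _ , consistent , []∈ , []∉) stable →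
    []∉ (consistent S⁰ C⁰ S′ C⁰ stable (λ _ _ → refl , refl) []∈) })
  where
  open Semantics P
  open Reachability P
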